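{- Let $P$ be a finite poset and $t\geq 2$ an integer, and suppose $\mathrm{sat}^{\star}([t]^n,P)=O(1)$ as $n\to\infty$. Then there exists $N\in\mathbb{Z}_{>0}$ such that the function $n\mapsto\mathrm{sat}^{\star}([t]^n,P)$ is constant on the integers $n>N$.
   Context: For positive integers $n,t$, $[n]=\{1,\dots,n\}$ and the hypergrid $[t]^n$ is the set of functions $f:[n]\to[t]$, partially ordered by $f\leq g$ iff $f(i)\leq g(i)$ for all $i\in[n]$. An induced copy of a poset $P$ in a family $\mathcal{F}\subseteq[t]^n$ is an injective map $\phi:P\to\mathcal{F}$ such that $\phi(x)\leq\phi(y)$ iff $x\leq_P y$. A family $\mathcal{F}\subseteq[t]^n$ is induced $P$-free if it contains no induced copy of $P$; it is induced $P$-saturated if it is induced $P$-free and for every $f\in[t]^n\setminus\mathcal{F}$ the family $\mathcal{F}\cup\{f\}$ contains an induced copy of $P$. Whenever $P$ embeds as an induced subposet of $[t]^n$, $\mathrm{sat}^{\star}([t]^n,P)$ denotes the minimum size of an induced $P$-saturated family in $[t]^n$. -}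

module Defs where

open import Data.Fin using (Fin) renaming (_≤_ to _≤ᶠ_)
open import Data.List using (List; _∷_; length)
open import Data.List.Membership.Propositional using (_∈_; _∉_)
open import Data.List.Relation.Unary.Unique.Propositional using (Unique)
open import Data.Nat using (ℕ; _≤_; _<_)
open import Data.Product using (Σ-syntax; ∃-syntax; _×_)
open import Data.Vec using (Vec; lookup)
open import Function.Bundles using (Inverse; _⇔_)
open import Function.Definitions using (Injective)
open import Level using (Level; _⊔_; 0ℓ)
open import Relation.Binary.Bundles using (Poset; module Poset)
open import Relation.Binary.PropositionalEquality using (_≡_; setoid)
open import Relation.Nullary using (¬_)
open import Relation.Unary using (Pred; U)

private
  variable
    c ℓ₁ ℓ₂ : Level

-- The underlying set of P is its carrier up to the poset's own equality _≈_.
FinitePoset : Poset c ℓ₁ ℓ₂ → Set (c ⊔ ℓ₁)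
FinitePoset P = ∃[ k ] Inverse (Poset.Eq.setoid P) (setoid (Fin k))

-- A function [n] → [t] is stored as its table of values, so that propositional
-- equality is equality of functions; {1,…,t} is shifted to {0,…,t-1}.
Grid : ℕ → ℕ → Set
Grid t n = Vec (Fin t) n

_≤ᵍ_ : {t n : ℕ} → Grid t n → Grid t n → Set
f ≤ᵍ g = ∀ i → lookup f i ≤ᶠ lookup g i

-- A subset of the (finite) hypergrid is a duplicate-free list of its elements.
record Family (t n : ℕ) : Set where
  constructor family
  field
    elements : List (Grid t n)
    unique   : Unique elements

  size : ℕ
  size = length elements

open Family public

record InducedCopy (P : Poset c ℓ₁ ℓ₂) {t n : ℕ}
                   (S : Pred (Grid t n) 0ℓ) : Set (c ⊔ ℓ₁ ⊔ ℓ₂) where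
  private module P = Poset P
  field
    φ         : P.Carrier → Grid t n
    φ-in      : ∀ x → S (φ x)
    injective : Injective P._≈_ _≡_ φ
    induced   : ∀ x y → (φ x ≤ᵍ φ y) ⇔ (x P.≤ y)

Embeds : Poset c ℓ₁ ℓ₂ → ℕ → ℕ → Set (c ⊔ ℓ₁ ⊔ ℓ₂)
Embeds P t n = InducedCopy P {t} {n} U

InducedFree : (P : Poset c ℓ₁ ℓ₂) {t n : ℕ} → Family t n → Set (c ⊔ ℓ₁ ⊔ ℓ₂)
InducedFree P F = ¬ InducedCopy P (_∈ elements F)

InducedSaturated : (P : Poset c ℓ₁ ℓ₂) {t n : ℕ} → Family t n → Set (c ⊔ ℓ₁ ⊔ ℓ₂)
InducedSaturated P F =
  InducedFree P F ×
  (∀ f → f ∉ elements F → InducedCopy P (_∈ (f ∷ elements F)))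

-- The graph of the partial function n ↦ sat⋆([t]ⁿ, P): Sat⋆ P t n s says that
-- sat⋆([t]ⁿ, P) is defined and equal to s.
record Sat⋆ (P : Poset c ℓ₁ ℓ₂) (t n s : ℕ) : Set (c ⊔ ℓ₁ ⊔ ℓ₂) where
  field
    embeds   : Embeds P t n
    attained : Σ[ F ∈ Family t n ] (InducedSaturated P F × size F ≡ s)
    minimal  : (F : Family t n) → InducedSaturated P F → s ≤ size F

-- For a function a given by its graph R: a(n) = O(1) as n → ∞.
IsO1 : {ℓ : Level} → (ℕ → ℕ → Set ℓ) → Set ℓ
IsO1 R = ∃[ C ] ∃[ n₀ ] (∀ n → n₀ ≤ n → ∃[ s ] (R n s × s ≤ C))

-- For a function a given by its graph R: a is constant on the integers n > N.
ConstantBeyond : {ℓ : Level} → ℕ → (ℕ → ℕ → Set ℓ) → Set ℓ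
ConstantBeyond N R = ∃[ s ] (∀ n → N < n → R n s)

{-# OPTIONS --safe #-}

-- Record a family of size s in [t]ⁿ as a table whose columns are the n coordinates; each column is
-- one of t ^ s possible ones, so for n > t ^ s two coordinates i ≠ j have equal columns. Deleting
-- one of them keeps the family saturated, since a new function of [t]ⁿ⁻¹ can be lifted by repeating
-- its value at i. Adding a third copy of the column keeps it saturated as well: the comparisons of
-- a function with the family depend, on the three copies, only on the minimum and the maximum of
-- its values there, and two coordinates suffice to realise those. So sat⋆ takes the same value at
-- n and n + 1 as soon as n exceeds t ^ C, where C bounds sat⋆.
module Submission where

open import Defs
open import Algebra.Construct.NaturalChoice.Max as Max using ()
open import Algebra.Construct.NaturalChoice.Min as Min using ()
open import Data.Fin as Fin using (Fin; zero; suc; punchIn; punchOut; funToFin; finToFun)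
open import Data.Fin.Properties as Fin using (pigeonhole; punchIn-punchOut; finToFun-funToFin)
open import Data.List as List using (List; []; _∷_)
open import Data.List.Membership.Propositional using (_∈_)
open import Data.List.Membership.Propositional.Properties using (∈-map⁺; ∈-map⁻)
open import Data.List.Properties using (length-map)
open import Data.List.Relation.Unary.All as All using ()
open import Data.List.Relation.Unary.All.Properties as All using ()
open import Data.List.Relation.Unary.AllPairs using ([]; _∷_)
open import Data.List.Relation.Unary.Any using (here; there; index)
open import Data.List.Relation.Unary.Any.Properties using (lookup-index)
open import Data.List.Relation.Unary.Unique.Propositional using (Unique)
open import Data.Nat using (ℕ; zero; suc; _+_; _∸_; _^_; _≤_; _<_; z<s; s≤s; NonZero; >-nonZero)
open import Data.Nat.Properties as ℕ using ()
open import Data.Product using (∃-syntax; _×_; _,_; proj₁; proj₂)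
open import Data.Vec using (_∷_; lookup; insertAt; removeAt; _[_]≔_)
open import Data.Vec.Properties using (insertAt-lookup; insertAt-punchIn; insertAt-removeAt; removeAt-punchOut; lookup∘update; lookup∘update′)
open import Data.Vec.Relation.Binary.Pointwise.Extensional using (ext; Pointwise-≡⇒≡)
open import Function.Base using (_∘_)
open import Function.Bundles using (_⇔_; mk⇔; module Equivalence)
open import Function.Construct.Composition using (_⇔-∘_)
open import Function.Construct.Symmetry using (⇔-sym)
open import Level using (Level; 0ℓ)
open import Relation.Binary.Bundles using (Poset)
open import Relation.Binary.PropositionalEquality using (_≡_; _≢_; refl; sym; trans; cong; subst; subst₂; ≢-sym)
open import Relation.Nullary using (yes; no)
open import Relation.Unary using (Pred)

open Equivalence using (to; from)

private
  variable
    c ℓ₁ ℓ₂ : Level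
    t m n : ℕ

-- Order on the hypergrid and transport of induced copies

≤ᵍ-reflexive : {f g : Grid t n} → f ≡ g → f ≤ᵍ g
≤ᵍ-reflexive refl i = Fin.≤-refl

≤ᵍ-refl : (f : Grid t n) → f ≤ᵍ f
≤ᵍ-refl f = ≤ᵍ-reflexive {f = f} refl

≤ᵍ-antisym : {f g : Grid t n} → f ≤ᵍ g → g ≤ᵍ f → f ≡ g
≤ᵍ-antisym f≤g g≤f = Pointwise-≡⇒≡ (ext λ i → Fin.≤-antisym (f≤g i) (g≤f i))

-- Injectivity is asked only on members of the list: deleting a coordinate is not injective on the
-- whole grid, but it is on a family in which that coordinate repeats another.
Unique-map⁺ : {a b : Level} {A : Set a} {B : Set b} (r : A → B) {xs : List A} →
  (∀ {x y} → x ∈ xs → y ∈ xs → r x ≡ r y → x ≡ y) → Unique xs → Unique (List.map r xs)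
Unique-map⁺ r inj [] = []
Unique-map⁺ r inj (x∉xs ∷ xs!) =
  All.map⁺ (All.tabulate λ y∈xs → All.lookup x∉xs y∈xs ∘ inj (here refl) (there y∈xs)) ∷
  Unique-map⁺ r (λ x∈xs y∈xs → inj (there x∈xs) (there y∈xs)) xs!

-- `σ` acts on membership proofs, so it may choose preimages or treat one added function separately.
-- Injectivity comes for free: equal images compare both ways, and `P` is antisymmetric.
transport-copy : (P : Poset c ℓ₁ ℓ₂) {S : Pred (Grid t n) 0ℓ} {T : Pred (Grid t m) 0ℓ}
  (σ : ∀ {f} → S f → Grid t m) → (∀ {f} (p : S f) → T (σ p)) →
  (∀ {f g} (p : S f) (q : S g) → (σ p ≤ᵍ σ q) ⇔ (f ≤ᵍ g)) →
  InducedCopy P S → InducedCopy P T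
transport-copy P σ σ-in σ-≤ copy = record
  { φ         = ψ
  ; φ-in      = λ x → σ-in (φ-in x)
  ; injective = λ {x} {y} eq → P.antisym
      (to (ψ-induced x y) (≤ᵍ-reflexive eq))
      (to (ψ-induced y x) (≤ᵍ-reflexive (sym eq)))
  ; induced   = ψ-induced
  }
  where
  module P = Poset P
  open InducedCopy copy
  ψ : P.Carrier → Grid _ _
  ψ x = σ (φ-in x)
  ψ-induced : ∀ x y → (ψ x ≤ᵍ ψ y) ⇔ (x P.≤ y)
  ψ-induced x y = induced x y ⇔-∘ σ-≤ (φ-in x) (φ-in y)

-- The map q picks, for each candidate h in [t]ᵐ, a function in [t]ⁿ that compares with F exactly
-- as h compares with the image of F.
record Transfer (F : Family t n) (m : ℕ) : Set where
  field
    r   : Grid t n → Grid t m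
    q   : Grid t m → Grid t n
    emb : ∀ {f g} → f ∈ elements F → g ∈ elements F → (r f ≤ᵍ r g) ⇔ (f ≤ᵍ g)
    lo  : ∀ {f} h → f ∈ elements F → (h ≤ᵍ r f) ⇔ (q h ≤ᵍ f)
    hi  : ∀ {f} h → f ∈ elements F → (r f ≤ᵍ h) ⇔ (f ≤ᵍ q h)

  r-injective : ∀ {f g} → f ∈ elements F → g ∈ elements F → r f ≡ r g → f ≡ g
  r-injective {f} {g} f∈F g∈F eq = ≤ᵍ-antisym
    (to (emb f∈F g∈F) (≤ᵍ-reflexive eq))
    (to (emb g∈F f∈F) (≤ᵍ-reflexive (sym eq)))

  image : Family t m
  image = family (List.map r (elements F)) (Unique-map⁺ r r-injective (unique F))

  -- Taking `f` to be `q h` itself in `lo` and `hi` squeezes `h` between two copies of `r (q h)`.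
  -- Hence a function `h` outside the image yields `q h` outside `F`, where saturation applies.
  q-reflects-∈ : ∀ {h} → q h ∈ elements F → h ∈ elements image
  q-reflects-∈ {h} qh∈F = subst (_∈ elements image)
    (sym (≤ᵍ-antisym (from (lo h qh∈F) (≤ᵍ-refl (q h))) (from (hi h qh∈F) (≤ᵍ-refl (q h)))))
    (∈-map⁺ r qh∈F)

  image-free : (P : Poset c ℓ₁ ℓ₂) → InducedFree P F → InducedFree P image
  image-free P free copy = free (transport-copy P
    (λ p → proj₁ (∈-map⁻ r p)) (λ p → proj₁ (proj₂ (∈-map⁻ r p))) σ-≤ copy)
    where
    σ-≤ : ∀ {f g} (p : f ∈ elements image) (p′ : g ∈ elements image) →
      (proj₁ (∈-map⁻ r p) ≤ᵍ proj₁ (∈-map⁻ r p′)) ⇔ (f ≤ᵍ g)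
    σ-≤ p p′ with ∈-map⁻ r p | ∈-map⁻ r p′
    ... | _ , x∈F , refl | _ , y∈F , refl = ⇔-sym (emb x∈F y∈F)

  image-saturated : (P : Poset c ℓ₁ ℓ₂) → InducedSaturated P F → InducedSaturated P image
  image-saturated P (free , sat) = image-free P free , λ h h∉ →
    -- The copy found after adding `q h` to `F` is carried over by sending `q h` to `h` and every
    -- member of `F` along `r`.
    transport-copy P (σ h) (σ-in h) (σ-≤ h) (sat (q h) (h∉ ∘ q-reflects-∈))
    where
    σ : ∀ h {f} → f ∈ (q h ∷ elements F) → Grid _ _
    σ h (here _)      = h
    σ h {f} (there _) = r f
    σ-in : ∀ h {f} (p : f ∈ (q h ∷ elements F)) → σ h p ∈ (h ∷ elements image)
    σ-in h (here _)    = here refl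
    σ-in h (there f∈F) = there (∈-map⁺ r f∈F)
    σ-≤ : ∀ h {f g} (p : f ∈ (q h ∷ elements F)) (p′ : g ∈ (q h ∷ elements F)) →
      (σ h p ≤ᵍ σ h p′) ⇔ (f ≤ᵍ g)
    σ-≤ h (here refl) (here refl) = mk⇔ (λ _ → ≤ᵍ-refl (q h)) (λ _ → ≤ᵍ-refl h)
    σ-≤ h (here refl) (there g∈F) = lo h g∈F
    σ-≤ h (there f∈F) (here refl) = hi h f∈F
    σ-≤ h (there f∈F) (there g∈F) = emb f∈F g∈F

transfer⇒sat-≤ : (P : Poset c ℓ₁ ℓ₂) {s : ℕ} (F : Family t n) → InducedSaturated P F →
  Transfer F m → Sat⋆ P t m s → s ≤ size F
transfer⇒sat-≤ P F sat T S = ℕ.≤-trans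
  (Sat⋆.minimal S (Transfer.image T) (Transfer.image-saturated T P sat))
  (ℕ.≤-reflexive (length-map (Transfer.r T) (elements F)))

-- Repeated columns by pigeonhole

record EqualColumns (F : Family t n) : Set where
  field
    i j   : Fin n
    i≢j   : i ≢ j
    equal : ∀ {f} → f ∈ elements F → lookup f i ≡ lookup f j

equalColumns : (F : Family t n) → t ^ size F < n → EqualColumns F
equalColumns F t^s<n with pigeonhole t^s<n
  (λ i → funToFin (λ k → lookup (List.lookup (elements F) k) i))
... | i , j , i<j , eq = record
  { i     = i
  ; j     = j
  ; i≢j   = Fin.<⇒≢ i<j
  ; equal = λ f∈F → subst (λ f → lookup f i ≡ lookup f j) (sym (lookup-index f∈F)) (equal-at (index f∈F))
  }
  where
  equal-at : ∀ k → lookup (List.lookup (elements F) k) i ≡ lookup (List.lookup (elements F) k) j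
  -- Equal codes in `Fin (t ^ size F)` are decoded entry by entry.
  equal-at k = trans (sym (finToFun-funToFin _ k))
    (trans (cong (λ x → finToFun x k) eq) (finToFun-funToFin _ k))

-- Deleting and adding a copy of a column

duplicate : Fin (suc n) → Fin n → Grid t n → Grid t (suc n)
duplicate j i f = insertAt f j (lookup f i)

-- The comparison at the inserted position `j` repeats the one at `i`, so it adds no constraint.
duplicate-≤ : (j : Fin (suc n)) (i : Fin n) (f g : Grid t n) →
  (duplicate j i f ≤ᵍ duplicate j i g) ⇔ (f ≤ᵍ g)
duplicate-≤ j i f g = mk⇔
  (λ le k → subst₂ Fin._≤_ (insertAt-punchIn f j _ k) (insertAt-punchIn g j _ k) (le (punchIn j k)))
  mono
  where
  mono : f ≤ᵍ g → duplicate j i f ≤ᵍ duplicate j i g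
  mono f≤g k with j Fin.≟ k
  ... | yes refl = subst₂ Fin._≤_ (sym (insertAt-lookup f j _)) (sym (insertAt-lookup g j _)) (f≤g i)
  ... | no j≢k = subst (λ k → lookup (duplicate j i f) k Fin.≤ lookup (duplicate j i g) k)
    (punchIn-punchOut j≢k)
    (subst₂ Fin._≤_ (sym (insertAt-punchIn f j _ _)) (sym (insertAt-punchIn g j _ _)) (f≤g (punchOut j≢k)))

-- On `F`, `q` undoes `r`, because the deleted entry can be read off at `i`. All three conditions
-- then become instances of `duplicate-≤`.
delete-column : (F : Family t (suc n)) → EqualColumns F → Transfer F n
delete-column {t} {n} F E = record
  { r   = r
  ; q   = q
  ; emb = λ {f} {g} f∈F g∈F → subst₂ (λ f′ g′ → (r f ≤ᵍ r g) ⇔ (f′ ≤ᵍ g′)) (q∘r f∈F) (q∘r g∈F)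
      (⇔-sym (duplicate-≤ j i′ (r f) (r g)))
  ; lo  = λ {f} h f∈F → subst (λ f′ → (h ≤ᵍ r f) ⇔ (q h ≤ᵍ f′)) (q∘r f∈F) (⇔-sym (duplicate-≤ j i′ h (r f)))
  ; hi  = λ {f} h f∈F → subst (λ f′ → (r f ≤ᵍ h) ⇔ (f′ ≤ᵍ q h)) (q∘r f∈F) (⇔-sym (duplicate-≤ j i′ (r f) h))
  }
  where
  open EqualColumns E
  i′ : Fin n
  -- The position of `i` once `j` is removed.
  i′ = punchOut (≢-sym i≢j)
  r : Grid t (suc n) → Grid t n
  r f = removeAt f j
  q : Grid t n → Grid t (suc n)
  q = duplicate j i′
  q∘r : ∀ {f} → f ∈ elements F → q (r f) ≡ f
  q∘r {f} f∈F = trans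
    (cong (insertAt (r f) j) (trans (removeAt-punchOut f (≢-sym i≢j)) (equal f∈F)))
    (insertAt-removeAt f j)

add-column : (F : Family t n) → EqualColumns F → Transfer F (suc n)
add-column {t} {n} F E = record
  { r   = r
  ; q   = q
  ; emb = λ {f} {g} _ _ → duplicate-≤ zero i f g
  ; lo  = λ h f∈F → mk⇔ (lo⇒ h (equal f∈F)) (lo⇐ h (equal f∈F))
  ; hi  = λ h f∈F → mk⇔ (hi⇒ h (equal f∈F)) (hi⇐ h (equal f∈F))
  }
  where
  open EqualColumns E
  open Min (Fin.≤-totalOrder t) using (_⊓_; x⊓y≤x; x⊓y≤y; ⊓-glb)
  open Max (Fin.≤-totalOrder t) using (_⊔_; x≤x⊔y; x≤y⊔x; ⊔-lub)

  r : Grid t n → Grid t (suc n)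
  r = duplicate zero i

  low high : Grid t (suc n) → Fin t
  low  (a ∷ h) = a ⊓ (lookup h i ⊓ lookup h j)
  high (a ∷ h) = a ⊔ (lookup h i ⊔ lookup h j)

  q : Grid t (suc n) → Grid t n
  -- The minimum goes to `i` and the maximum to `j`; as `i ≢ j`, the second update leaves the first
  -- intact.
  q (a ∷ h) = (h [ i ]≔ low (a ∷ h)) [ j ]≔ high (a ∷ h)

  q-i : ∀ h → lookup (q h) i ≡ low h
  q-i (a ∷ h) = trans (lookup∘update′ i≢j (h [ i ]≔ low (a ∷ h)) _) (lookup∘update i h _)

  q-j : ∀ h → lookup (q h) j ≡ high h
  q-j (a ∷ h) = lookup∘update j (h [ i ]≔ low (a ∷ h)) _

  q-k : ∀ a h {k} → k ≢ i → k ≢ j → lookup (q (a ∷ h)) k ≡ lookup h k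
  q-k a h k≢i k≢j = trans (lookup∘update′ k≢j (h [ i ]≔ low (a ∷ h)) _) (lookup∘update′ k≢i h _)

  lo⇒ : ∀ h {f} → lookup f i ≡ lookup f j → h ≤ᵍ r f → q h ≤ᵍ f
  lo⇒ (a ∷ h) {f} eq le k with k Fin.≟ i | k Fin.≟ j
  ... | yes refl | _ = subst (Fin._≤ lookup f i) (sym (q-i (a ∷ h)))
    (ℕ.≤-trans (x⊓y≤x a (lookup h i ⊓ lookup h j)) (le zero))
  -- The maximum needs the bounds at all three copies; at `i`, where the minimum sits, one was
  -- enough.
  ... | no _ | yes refl = subst (Fin._≤ lookup f j) (sym (q-j (a ∷ h)))
    (⊔-lub (subst (a Fin.≤_) eq (le zero)) (⊔-lub (subst (lookup h i Fin.≤_) eq (le (suc i))) (le (suc j))))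
  ... | no k≢i | no k≢j = subst (Fin._≤ lookup f k) (sym (q-k a h k≢i k≢j)) (le (suc k))

  lo⇐ : ∀ h {f} → lookup f i ≡ lookup f j → q h ≤ᵍ f → h ≤ᵍ r f
  lo⇐ (a ∷ h) {f} eq le = λ where
      zero → ℕ.≤-trans (x≤x⊔y a (lookup h i ⊔ lookup h j)) high≤
      (suc k) → tail k
    where
    high≤ : high (a ∷ h) Fin.≤ lookup f i
    -- The inequality at `j` alone controls all three copies, since `q` stores their maximum there.
    high≤ = subst₂ Fin._≤_ (q-j (a ∷ h)) (sym eq) (le j)
    tail : h ≤ᵍ f
    tail k with k Fin.≟ i | k Fin.≟ j
    ... | yes refl | _ = ℕ.≤-trans (ℕ.≤-trans (x≤x⊔y (lookup h i) (lookup h j)) (x≤y⊔x a (lookup h i ⊔ lookup h j))) high≤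
    ... | no _ | yes refl = ℕ.≤-trans
      (ℕ.≤-trans (x≤y⊔x (lookup h i) (lookup h j)) (x≤y⊔x a (lookup h i ⊔ lookup h j)))
      (subst (high (a ∷ h) Fin.≤_) eq high≤)
    ... | no k≢i | no k≢j = subst (Fin._≤ lookup f k) (q-k a h k≢i k≢j) (le k)

  hi⇒ : ∀ h {f} → lookup f i ≡ lookup f j → r f ≤ᵍ h → f ≤ᵍ q h
  hi⇒ (a ∷ h) {f} eq le k with k Fin.≟ i | k Fin.≟ j
  ... | yes refl | _ = subst (lookup f i Fin.≤_) (sym (q-i (a ∷ h)))
    (⊓-glb (le zero) (⊓-glb (le (suc i)) (subst (Fin._≤ lookup h j) (sym eq) (le (suc j)))))
  ... | no _ | yes refl = subst₂ Fin._≤_ eq (sym (q-j (a ∷ h)))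
    (ℕ.≤-trans (le zero) (x≤x⊔y a (lookup h i ⊔ lookup h j)))
  ... | no k≢i | no k≢j = subst (lookup f k Fin.≤_) (sym (q-k a h k≢i k≢j)) (le (suc k))

  hi⇐ : ∀ h {f} → lookup f i ≡ lookup f j → f ≤ᵍ q h → r f ≤ᵍ h
  hi⇐ (a ∷ h) {f} eq le = λ where
      zero → ℕ.≤-trans ≤low (x⊓y≤x a (lookup h i ⊓ lookup h j))
      (suc k) → tail k
    where
    ≤low : lookup f i Fin.≤ low (a ∷ h)
    -- Dually, the minimum stored at `i` controls all three copies from below.
    ≤low = subst (lookup f i Fin.≤_) (q-i (a ∷ h)) (le i)
    tail : f ≤ᵍ h
    tail k with k Fin.≟ i | k Fin.≟ j
    ... | yes refl | _ = ℕ.≤-trans ≤low (ℕ.≤-trans (x⊓y≤y a (lookup h i ⊓ lookup h j)) (x⊓y≤x (lookup h i) (lookup h j)))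
    ... | no _ | yes refl = ℕ.≤-trans (subst (Fin._≤ low (a ∷ h)) eq ≤low)
      (ℕ.≤-trans (x⊓y≤y a (lookup h i ⊓ lookup h j)) (x⊓y≤y (lookup h i) (lookup h j)))
    ... | no k≢i | no k≢j = subst (lookup f k Fin.≤_) (q-k a h k≢i k≢j) (le k)

-- Stabilisation

sat-step : (P : Poset c ℓ₁ ℓ₂) {s s′ : ℕ} → t ^ s < n → t ^ s′ < suc n →
  Sat⋆ P t n s → Sat⋆ P t (suc n) s′ → s ≡ s′
sat-step P small small′ S S′
  with F  , sat  , refl ← Sat⋆.attained S
     | F′ , sat′ , refl ← Sat⋆.attained S′ = ℕ.≤-antisym
  -- Deletion from an optimal family in dimension `suc n` gives `s ≤ s′`; addition to one in
  -- dimension `n` gives `s′ ≤ s`.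
  (transfer⇒sat-≤ P F′ sat′ (delete-column F′ (equalColumns F′ small′)) S)
  (transfer⇒sat-≤ P F sat (add-column F (equalColumns F small)) S′)

mainTheorem2 : {c ℓ₁ ℓ₂ : Level} (P : Poset c ℓ₁ ℓ₂) → FinitePoset P →
    (t : ℕ) → 2 ≤ t → IsO1 (Sat⋆ P t) →
    ∃[ N ] (0 < N × ConstantBeyond N (Sat⋆ P t))
mainTheorem2 P _ t 2≤t (C , n₀ , bounded) = N , z<s , s₀ , λ n N<n →
  subst (λ n → Sat⋆ P t n s₀) (ℕ.m∸n+n≡m N<n) (constant (n ∸ suc N))
  where
  instance
    t≢0 : NonZero t
    t≢0 = >-nonZero (ℕ.<-trans z<s 2≤t)

  N : ℕ
  -- Beyond `n₀` the bound `C` holds, beyond `t ^ C` a minimum family repeats a column, and the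
  -- successor makes `N` positive.
  N = suc (n₀ + t ^ C)

  n₀≤ : ∀ d → n₀ ≤ d + suc N
  n₀≤ d = ℕ.m≤n⇒m≤o+n d (ℕ.m≤n⇒m≤1+n (ℕ.m≤n⇒m≤1+n (ℕ.m≤m+n n₀ (t ^ C))))

  small : ∀ {s} d → s ≤ C → t ^ s < d + suc N
  small d s≤C = ℕ.m≤n⇒m≤o+n d
    (ℕ.m≤n⇒m≤1+n (s≤s (ℕ.≤-trans (ℕ.^-monoʳ-≤ t s≤C) (ℕ.m≤n+m (t ^ C) n₀))))

  s₀ : ℕ
  s₀ = proj₁ (bounded (suc N) (n₀≤ 0))

  s₀≤C : s₀ ≤ C
  s₀≤C = proj₂ (proj₂ (bounded (suc N) (n₀≤ 0)))

  constant : ∀ d → Sat⋆ P t (d + suc N) s₀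
  constant zero    = proj₁ (proj₂ (bounded (suc N) (n₀≤ 0)))
  constant (suc d) with bounded (suc d + suc N) (n₀≤ (suc d))
  ... | s , S , s≤C = subst (Sat⋆ P t _)
    -- Boundedness supplies some value `s` in the next dimension; `sat-step` identifies it with
    -- `s₀`.
    (sym (sat-step P (small d s₀≤C) (small (suc d) s≤C) (constant d) S)) S
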